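{- For integers $n,r$ with $3\le r\le n-3$, there is no graph $H$ with $\mathsf{TS}_2(H)\cong J(n,r)$; that is, $2\notin\mathcal{K}^{\mathsf{TS}}(J(n,r))$.
   Context: All graphs are finite, simple, undirected. A $k$-clique of a graph $H$ is a set of $k$ pairwise adjacent vertices. For a graph $H$ and integer $k\ge1$, the Token Sliding graph $\mathsf{TS}_k(H)$ has as vertices the $k$-cliques of $H$, and two $k$-cliques $A,B$ are adjacent iff $A\setminus B=\{u\}$, $B\setminus A=\{v\}$ for some vertices $u,v$ with $uv\in E(H)$. $\mathcal{K}^{\mathsf{TS}}(G)=\{k\ge1:\ \exists H,\ \mathsf{TS}_k(H)\cong G\}$. The Johnson graph $J(n,r)$ has as vertices the $r$-subsets of $\{1,\dots,n\}$, two being adjacent iff their intersection has size $r-1$. -}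

module Defs where

open import Data.Bool using (true; false) renaming (_≟_ to _≟ᵇ_)
open import Data.Fin using (Fin)
open import Data.Fin.Properties using (any?)
open import Data.Fin.Subset using (Subset; _∈_; _∩_; _─_; ⁅_⁆; ∣_∣)
open import Data.Fin.Subset.Properties using (x∈⁅x⁆; ∩-idem; ∩-comm)
open import Data.Irrelevant using ([_])
open import Data.Nat using (ℕ; suc; _≤_; _≟_)
open import Data.Nat.Properties using (1+n≢n)
open import Data.Product using (∃-syntax; Σ-syntax; _×_; _,_)
open import Data.Refinement using (Refinement-syntax; value; _,_)
open import Data.Vec using (_∷_; there)
open import Data.Vec.Properties using (≡-dec)
open import Function.Bundles using (_↔_; _⇔_; Inverse)
open import Level using (0ℓ) renaming (suc to lsuc)
open import Relation.Binary using (Rel; Decidable; Symmetric; Irreflexive)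
open import Relation.Binary.PropositionalEquality
  using (_≡_; _≢_; refl; sym; trans; cong; subst)
open import Relation.Nullary using (¬_; _×-dec_; recompute)
open import Relation.Unary using (Pred)

-- Simple undirected graphs with vertex type V.  Finiteness is a matter of the
-- choice of V: a finite graph is, up to isomorphism, a Graph (Fin m).
-- Decidability of adjacency is automatic classically.
record Graph (V : Set) : Set₁ where
  field
    Adj        : Rel V 0ℓ
    adj?       : Decidable Adj
    adj-sym    : Symmetric Adj
    adj-irrefl : Irreflexive _≡_ Adj

open Graph public

infix 4 _≅_

_≅_ : ∀ {V W} → Graph V → Graph W → Set
_≅_ {V} {W} G H =
  Σ[ f ∈ V ↔ W ] (∀ x y → Adj G x y ⇔ Adj H (Inverse.to f x) (Inverse.to f y))

module _ {m : ℕ} where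

  IsClique : Graph (Fin m) → Subset m → Set
  IsClique H A = ∀ {u v} → u ∈ A → v ∈ A → u ≢ v → Adj H u v

  -- The proof component of a refinement is irrelevant, so two k-cliques are
  -- equal exactly when their underlying sets are.
  Clique : ℕ → Graph (Fin m) → Set
  Clique k H = [ A ∈ Subset m ∣ (IsClique H A × ∣ A ∣ ≡ k) ]

  -- A ∖ B = {u} and B ∖ A = {v} for some edge uv of H.
  Slide : Graph (Fin m) → Rel (Subset m) 0ℓ
  Slide H A B = ∃[ u ] ∃[ v ] (A ─ B ≡ ⁅ u ⁆ × B ─ A ≡ ⁅ v ⁆ × Adj H u v)

  private
    slide? : ∀ H → Decidable (Slide H)
    slide? H A B = any? λ u → any? λ v →
      ≡-dec _≟ᵇ_ (A ─ B) ⁅ u ⁆ ×-dec ≡-dec _≟ᵇ_ (B ─ A) ⁅ v ⁆ ×-dec adj? H u v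

    slide-sym : ∀ H → Symmetric (Slide H)
    slide-sym H (u , v , p , q , e) = v , u , q , p , adj-sym H e

    x∉p─p : ∀ {n} {x : Fin n} (p : Subset n) → ¬ (x ∈ p ─ p)
    x∉p─p (true  ∷ p) (there x∈) = x∉p─p p x∈
    x∉p─p (false ∷ p) (there x∈) = x∉p─p p x∈

    slide-irrefl : ∀ H A → ¬ Slide H A A
    slide-irrefl H A (u , _ , p , _) = x∉p─p A (subst (u ∈_) (sym p) (x∈⁅x⁆ u))

  TS : (k : ℕ) (H : Graph (Fin m)) → Graph (Clique k H)
  TS k H = record
    { Adj        = λ A B → Slide H (value A) (value B)
    ; adj?       = λ A B → slide? H (value A) (value B)
    ; adj-sym    = slide-sym H
    ; adj-irrefl = λ { {A} refl → slide-irrefl H (value A) }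
    }

𝒦ᵀˢ : ∀ {V} → Graph V → Pred ℕ (lsuc 0ℓ)
𝒦ᵀˢ G k = 1 ≤ k × ∃[ m ] Σ[ H ∈ Graph (Fin m) ] TS k H ≅ G

-- As for cliques, r-subsets are equal exactly when their underlying sets are.
SubsetOfSize : ℕ → ℕ → Set
SubsetOfSize n r = [ A ∈ Subset n ∣ ∣ A ∣ ≡ r ]

-- "∣ A ∩ B ∣ = r − 1" is written without truncated subtraction, which would
-- put a loop at ∅ when r = 0.
J : (n r : ℕ) → Graph (SubsetOfSize n r)
J n r = record
  { Adj        = λ A B → suc ∣ value A ∩ value B ∣ ≡ r
  ; adj?       = λ A B → suc ∣ value A ∩ value B ∣ ≟ r
  ; adj-sym    = λ {A} {B} → trans (cong (λ C → suc ∣ C ∣) (∩-comm (value B) (value A)))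
  ; adj-irrefl = λ { {A , [ ∣A∣≡r ]} refl e →
      1+n≢n (trans (trans (cong (λ C → suc ∣ C ∣) (sym (∩-idem A))) e)
                   (sym (recompute (∣ A ∣ ≟ r) ∣A∣≡r))) }
  }

{-# OPTIONS --safe #-}
-- If two edges uw and vw of H are adjacent in TS₂(H), then uv is a common
-- neighbour of them there.  As sets, uv = uw △ vw, and for such a triple every
-- set h satisfies |h ∩ e| + |h ∩ f| + |h ∩ (e △ f)| ≡ 0 (mod 2); a common
-- neighbour h of all three would meet each of them in exactly one vertex.
-- Hence every edge of TS₂(H) lies in a triangle that is a maximal clique.  In
-- J(n,r) with 3 ≤ r ≤ n − 3 every triangle lies in a 4-clique: it consists of
-- three sets T ∪ {x} with |T| = r − 1, or of three sets U ∖ {x} with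
-- |U| = r + 1, and in either family there is room for a fourth member.
module Submission where

open import Defs
open import Data.Bool using (true; false)
open import Data.Fin using (Fin)
open import Data.Fin.Subset
  using (Subset; Nonempty; _∈_; _⊆_; _∩_; _∪_; _─_; _-_; ∁; ⁅_⁆; ∣_∣; ⊥)
  renaming (_∉_ to _∉ˢ_)
open import Data.Fin.Subset.Properties
open import Data.Irrelevant using ([_])
open import Data.Nat using (ℕ; zero; suc; _+_; _≤_; _<_; _≟_; _≤?_; s≤s; s≤s⁻¹)
open import Data.Nat.Properties
open import Data.Nat.Tactic.RingSolver using (solve-∀)
open import Data.Product using (∃-syntax; Σ-syntax; _×_; _,_; proj₁; proj₂)
open import Data.Refinement using (value; _,_)
open import Data.Sum using (inj₁; inj₂; [_,_]′)
open import Data.Vec using ([]; _∷_; here; there)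
open import Function using (_∘_)
open import Function.Bundles using (Inverse; Equivalence)
open import Relation.Binary.PropositionalEquality
  using (_≡_; _≢_; refl; sym; trans; cong; cong₂; subst; subst₂; module ≡-Reasoning)
open import Relation.Nullary using (¬_; yes; no; recompute; contradiction)
open import Relation.Unary using (_∉_)

-- Maximal triangles as an isomorphism invariant

module _ {V : Set} (G : Graph V) where

  MaximalTriangle : V → V → V → Set
  MaximalTriangle x y z =
    Adj G x z × Adj G y z × (∀ w → Adj G w x → Adj G w y → ¬ Adj G w z)

  EdgesInMaximalTriangles : Set
  EdgesInMaximalTriangles = ∀ x y → Adj G x y → ∃[ z ] MaximalTriangle x y z

EdgesInMaximalTriangles-resp-≅ : ∀ {V W} (G : Graph V) (H : Graph W) → G ≅ H →
  EdgesInMaximalTriangles G → EdgesInMaximalTriangles H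
EdgesInMaximalTriangles-resp-≅ G H (f , iso) max x y xy =
  let z , xz , yz , no-w = max (from x) (from y) (adj-from xy) in
  to z , adj-to xz , adj-to yz ,
  λ w wx wy wz → no-w (from w) (adj-from wx) (adj-from wy)
    (subst (Adj G (from w)) (strictlyInverseʳ z) (adj-from wz))
  where
  open Inverse f using (to; from; strictlyInverseˡ; strictlyInverseʳ)

  adj-from : ∀ {a b} → Adj H a b → Adj G (from a) (from b)
  adj-from {a} {b} ab = Equivalence.from (iso _ _)
    (subst₂ (Adj H) (sym (strictlyInverseˡ a)) (sym (strictlyInverseˡ b)) ab)

  -- Only the first endpoint comes from `H`; the third vertex `z` is found in `G` and is pushed
  -- forward directly.
  adj-to : ∀ {a c} → Adj G (from a) c → Adj H a (to c)
  adj-to {a} {c} ac =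
    subst (λ b → Adj H b (to c)) (strictlyInverseˡ a) (Equivalence.to (iso _ _) ac)

-- Counting in finite subsets

∣p∪q∣+∣p∩q∣≡∣p∣+∣q∣ : ∀ {n} (p q : Subset n) → ∣ p ∪ q ∣ + ∣ p ∩ q ∣ ≡ ∣ p ∣ + ∣ q ∣
∣p∪q∣+∣p∩q∣≡∣p∣+∣q∣ []          []          = refl
∣p∪q∣+∣p∩q∣≡∣p∣+∣q∣ (false ∷ p) (false ∷ q) = ∣p∪q∣+∣p∩q∣≡∣p∣+∣q∣ p q
∣p∪q∣+∣p∩q∣≡∣p∣+∣q∣ (false ∷ p) (true ∷ q)  =
  trans (cong suc (∣p∪q∣+∣p∩q∣≡∣p∣+∣q∣ p q)) (sym (+-suc ∣ p ∣ ∣ q ∣))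
∣p∪q∣+∣p∩q∣≡∣p∣+∣q∣ (true ∷ p)  (false ∷ q) = cong suc (∣p∪q∣+∣p∩q∣≡∣p∣+∣q∣ p q)
∣p∪q∣+∣p∩q∣≡∣p∣+∣q∣ (true ∷ p)  (true ∷ q)  = cong suc
  (trans (+-suc ∣ p ∪ q ∣ ∣ p ∩ q ∣)
    (trans (cong suc (∣p∪q∣+∣p∩q∣≡∣p∣+∣q∣ p q)) (sym (+-suc ∣ p ∣ ∣ q ∣))))

∣p∩q∣+∣p─q∣≡∣p∣ : ∀ {n} (p q : Subset n) → ∣ p ∩ q ∣ + ∣ p ─ q ∣ ≡ ∣ p ∣
∣p∩q∣+∣p─q∣≡∣p∣ []          []          = refl
∣p∩q∣+∣p─q∣≡∣p∣ (false ∷ p) (false ∷ q) = ∣p∩q∣+∣p─q∣≡∣p∣ p q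
∣p∩q∣+∣p─q∣≡∣p∣ (false ∷ p) (true ∷ q)  = ∣p∩q∣+∣p─q∣≡∣p∣ p q
∣p∩q∣+∣p─q∣≡∣p∣ (true ∷ p)  (false ∷ q) =
  trans (+-suc ∣ p ∩ q ∣ ∣ p ─ q ∣) (cong suc (∣p∩q∣+∣p─q∣≡∣p∣ p q))
∣p∩q∣+∣p─q∣≡∣p∣ (true ∷ p)  (true ∷ q)  = cong suc (∣p∩q∣+∣p─q∣≡∣p∣ p q)

x∈p─q⇒x∉q : ∀ {n} {x : Fin n} (p q : Subset n) → x ∈ p ─ q → x ∉ˢ q
x∈p─q⇒x∉q (_ ∷ p) (false ∷ q) (there x∈) (there x∈q) = x∈p─q⇒x∉q p q x∈ x∈q
x∈p─q⇒x∉q (_ ∷ p) (true ∷ q)  (there x∈) (there x∈q) = x∈p─q⇒x∉q p q x∈ x∈q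

∣p∣>0⇒Nonempty : ∀ {n} {p : Subset n} → 0 < ∣ p ∣ → Nonempty p
∣p∣>0⇒Nonempty {p = true ∷ p}  _   = Fin.zero , here
∣p∣>0⇒Nonempty {p = false ∷ p} 0<p with x , x∈p ← ∣p∣>0⇒Nonempty {p = p} 0<p =
  Fin.suc x , there x∈p

∣p∣≡0⇒p≡⊥ : ∀ {n} {p : Subset n} → ∣ p ∣ ≡ 0 → p ≡ ⊥
∣p∣≡0⇒p≡⊥ {p = []}        _   = refl
∣p∣≡0⇒p≡⊥ {p = false ∷ p} p≡0 = cong (false ∷_) (∣p∣≡0⇒p≡⊥ p≡0)

∣p∣≡1⇒p≡⁅x⁆ : ∀ {n} {p : Subset n} → ∣ p ∣ ≡ 1 → ∃[ x ] p ≡ ⁅ x ⁆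
∣p∣≡1⇒p≡⁅x⁆ {p = true ∷ p}  p≡1 = Fin.zero , cong (true ∷_) (∣p∣≡0⇒p≡⊥ (suc-injective p≡1))
∣p∣≡1⇒p≡⁅x⁆ {p = false ∷ p} p≡1 with x , p≡ ← ∣p∣≡1⇒p≡⁅x⁆ {p = p} p≡1 =
  Fin.suc x , cong (false ∷_) p≡

∣p∣<n⇒∃x∉p : ∀ {n} {p : Subset n} → ∣ p ∣ < n → ∃[ x ] x ∉ˢ p
∣p∣<n⇒∃x∉p {p = p} p<n
  with x , x∈∁p ← ∣p∣>0⇒Nonempty (subst (0 <_) (sym (∣∁p∣≡n∸∣p∣ p)) (m<n⇒0<n∸m p<n))
  = x , x∈∁p⇒x∉p x∈∁p

x∉p⇒∣p∪⁅x⁆∣≡1+∣p∣ : ∀ {n} {x : Fin n} {p : Subset n} → x ∉ˢ p → ∣ p ∪ ⁅ x ⁆ ∣ ≡ suc ∣ p ∣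
x∉p⇒∣p∪⁅x⁆∣≡1+∣p∣ {n} {x} {p} x∉p = begin
  ∣ p ∪ ⁅ x ⁆ ∣                 ≡⟨ +-identityʳ _ ⟨
  ∣ p ∪ ⁅ x ⁆ ∣ + 0             ≡⟨ cong (∣ p ∪ ⁅ x ⁆ ∣ +_) disjoint ⟨
  ∣ p ∪ ⁅ x ⁆ ∣ + ∣ p ∩ ⁅ x ⁆ ∣ ≡⟨ ∣p∪q∣+∣p∩q∣≡∣p∣+∣q∣ p ⁅ x ⁆ ⟩
  ∣ p ∣ + ∣ ⁅ x ⁆ ∣             ≡⟨ cong (∣ p ∣ +_) (∣⁅x⁆∣≡1 x) ⟩
  ∣ p ∣ + 1                     ≡⟨ +-comm ∣ p ∣ 1 ⟩
  suc ∣ p ∣                     ∎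
  where
  open ≡-Reasoning
  disjoint : ∣ p ∩ ⁅ x ⁆ ∣ ≡ 0
  disjoint = trans (cong ∣_∣ (Empty-unique λ (y , y∈) →
    let y∈p , y∈⁅x⁆ = x∈p∩q⁻ p ⁅ x ⁆ y∈
    in x∉p (subst (_∈ p) (x∈⁅y⁆⇒x≡y x y∈⁅x⁆) y∈p))) (∣⊥∣≡0 n)

x∈p⇒1+∣p-x∣≡∣p∣ : ∀ {n} {x : Fin n} {p : Subset n} → x ∈ p → suc ∣ p - x ∣ ≡ ∣ p ∣
x∈p⇒1+∣p-x∣≡∣p∣ {x = x} {p} x∈p = begin
  suc ∣ p - x ∣                 ≡⟨ cong (_+ ∣ p - x ∣) (trans (cong ∣_∣ p∩⁅x⁆≡⁅x⁆) (∣⁅x⁆∣≡1 x)) ⟨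
  ∣ p ∩ ⁅ x ⁆ ∣ + ∣ p ─ ⁅ x ⁆ ∣ ≡⟨ ∣p∩q∣+∣p─q∣≡∣p∣ p ⁅ x ⁆ ⟩
  ∣ p ∣                         ∎
  where
  open ≡-Reasoning
  p∩⁅x⁆≡⁅x⁆ : p ∩ ⁅ x ⁆ ≡ ⁅ x ⁆
  p∩⁅x⁆≡⁅x⁆ = ⊆-antisym (p∩q⊆q p ⁅ x ⁆) λ y∈ →
    x∈p∩q⁺ (subst (_∈ p) (sym (x∈⁅y⁆⇒x≡y x y∈)) x∈p , y∈)

-- Symmetric difference

infixr 6 _△_

-- Written with the two differences that occur in `Slide`, so that a slide along `uv` turns it into
-- `⁅ u ⁆ ∪ ⁅ v ⁆` by rewriting.
_△_ : ∀ {n} → Subset n → Subset n → Subset n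
p △ q = (p ─ q) ∪ (q ─ p)

△-comm : ∀ {n} (p q : Subset n) → p △ q ≡ q △ p
△-comm p q = ∪-comm (p ─ q) (q ─ p)

-- Together with `[p△q]─p≡q─p`, this computes the two differences that a slide from `p` to `p △ q`
-- requires to be singletons.
p─[p△q]≡p∩q : ∀ {n} (p q : Subset n) → p ─ (p △ q) ≡ p ∩ q
p─[p△q]≡p∩q []          []          = refl
p─[p△q]≡p∩q (false ∷ p) (false ∷ q) = cong (false ∷_) (p─[p△q]≡p∩q p q)
p─[p△q]≡p∩q (false ∷ p) (true ∷ q)  = cong (false ∷_) (p─[p△q]≡p∩q p q)
p─[p△q]≡p∩q (true ∷ p)  (false ∷ q) = cong (false ∷_) (p─[p△q]≡p∩q p q)
p─[p△q]≡p∩q (true ∷ p)  (true ∷ q)  = cong (true ∷_) (p─[p△q]≡p∩q p q)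

[p△q]─p≡q─p : ∀ {n} (p q : Subset n) → (p △ q) ─ p ≡ q ─ p
[p△q]─p≡q─p []          []          = refl
[p△q]─p≡q─p (false ∷ p) (false ∷ q) = cong (false ∷_) ([p△q]─p≡q─p p q)
[p△q]─p≡q─p (false ∷ p) (true ∷ q)  = cong (true ∷_) ([p△q]─p≡q─p p q)
[p△q]─p≡q─p (true ∷ p)  (false ∷ q) = cong (false ∷_) ([p△q]─p≡q─p p q)
[p△q]─p≡q─p (true ∷ p)  (true ∷ q)  = cong (false ∷_) ([p△q]─p≡q─p p q)

-- Points of `h` in exactly one of `p` and `q` count once, points in both count twice. The
-- congruence mod 2 is kept as an exact equation with the even term `i + i`.
∣h∩p∣+∣h∩q∣ : ∀ {n} (h p q : Subset n) → let i = ∣ h ∩ (p ∩ q) ∣ in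
  ∣ h ∩ p ∣ + ∣ h ∩ q ∣ ≡ ∣ h ∩ (p △ q) ∣ + (i + i)
∣h∩p∣+∣h∩q∣ []          []          []          = refl
∣h∩p∣+∣h∩q∣ (false ∷ h) (_ ∷ p)     (_ ∷ q)     = ∣h∩p∣+∣h∩q∣ h p q
∣h∩p∣+∣h∩q∣ (true ∷ h)  (false ∷ p) (false ∷ q) = ∣h∩p∣+∣h∩q∣ h p q
∣h∩p∣+∣h∩q∣ (true ∷ h)  (false ∷ p) (true ∷ q)  =
  trans (+-suc ∣ h ∩ p ∣ ∣ h ∩ q ∣) (cong suc (∣h∩p∣+∣h∩q∣ h p q))
∣h∩p∣+∣h∩q∣ (true ∷ h)  (true ∷ p)  (false ∷ q) = cong suc (∣h∩p∣+∣h∩q∣ h p q)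
∣h∩p∣+∣h∩q∣ (true ∷ h)  (true ∷ p)  (true ∷ q)  = begin
  suc (∣ h ∩ p ∣ + suc ∣ h ∩ q ∣) ≡⟨ cong suc (+-suc ∣ h ∩ p ∣ ∣ h ∩ q ∣) ⟩
  2 + (∣ h ∩ p ∣ + ∣ h ∩ q ∣)     ≡⟨ cong (2 +_) (∣h∩p∣+∣h∩q∣ h p q) ⟩
  2 + (d + (i + i))               ≡⟨ shift d i ⟩
  d + (suc i + suc i)             ∎
  where
  open ≡-Reasoning
  d = ∣ h ∩ (p △ q) ∣
  i = ∣ h ∩ (p ∩ q) ∣
  shift : ∀ d i → 2 + (d + (i + i)) ≡ d + (suc i + suc i)
  shift = solve-∀

2≢1+i+i : ∀ i → 2 ≢ 1 + (i + i)
2≢1+i+i (suc i) eq with () ← trans (suc-injective (suc-injective eq)) (+-suc i i)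

-- Triangles in `TS 2 H`

module _ {m : ℕ} (H : Graph (Fin m)) where

  -- One of the two tokens moves; the other is the common vertex.
  Slide⇒∣∩∣≡1 : ∀ {p q} → ∣ p ∣ ≡ 2 → Slide H p q → ∣ p ∩ q ∣ ≡ 1
  Slide⇒∣∩∣≡1 {p} {q} ∣p∣≡2 (u , _ , p─q≡⁅u⁆ , _) = +-cancelʳ-≡ 1 _ _ (begin
    ∣ p ∩ q ∣ + 1         ≡⟨ cong (∣ p ∩ q ∣ +_) (trans (cong ∣_∣ p─q≡⁅u⁆) (∣⁅x⁆∣≡1 u)) ⟨
    ∣ p ∩ q ∣ + ∣ p ─ q ∣ ≡⟨ ∣p∩q∣+∣p─q∣≡∣p∣ p q ⟩
    ∣ p ∣                 ≡⟨ ∣p∣≡2 ⟩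
    2                     ∎)
    where open ≡-Reasoning

  -- With `p = uw` and `q = vw`, the token on `u` stays and the one on `w` moves to `v`. The edge it
  -- slides along is `q` itself, hence the clique hypothesis on `q`.
  △-slide : ∀ {p q} → IsClique H q → ∣ p ∣ ≡ 2 → Slide H p q → Slide H p (p △ q)
  △-slide {p} {q} cq ∣p∣≡2 pq@(u , v , p─q≡⁅u⁆ , q─p≡⁅v⁆ , uv)
    with w , p∩q≡⁅w⁆ ← ∣p∣≡1⇒p≡⁅x⁆ (Slide⇒∣∩∣≡1 ∣p∣≡2 pq) =
    w , v , trans (p─[p△q]≡p∩q p q) p∩q≡⁅w⁆ , trans ([p△q]─p≡q─p p q) q─p≡⁅v⁆ ,
    cq w∈q (p─q⊆p q p v∈q─p) λ w≡v → x∈p─q⇒x∉q q p v∈q─p (subst (_∈ p) w≡v w∈p)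
    where
    w∈p∩q : w ∈ p ∩ q
    w∈p∩q = subst (w ∈_) (sym p∩q≡⁅w⁆) (x∈⁅x⁆ w)
    w∈p = proj₁ (x∈p∩q⁻ p q w∈p∩q)
    w∈q = proj₂ (x∈p∩q⁻ p q w∈p∩q)
    v∈q─p : v ∈ q ─ p
    v∈q─p = subst (v ∈_) (sym q─p≡⁅v⁆) (x∈⁅x⁆ v)

  -- Here sliding matters, as opposed to jumping: the move from `p` to `q` takes place along `uv`,
  -- so `uv` is an edge.
  △-clique : ∀ {p q} → Slide H p q → IsClique H (p △ q)
  △-clique {p} {q} (u , v , p─q≡⁅u⁆ , q─p≡⁅v⁆ , uv) {x} {y} x∈ y∈ x≢y
    with x∈p∪q⁻ (p ─ q) (q ─ p) x∈ | x∈p∪q⁻ (p ─ q) (q ─ p) y∈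
  ... | inj₁ x∈u | inj₁ y∈u =
    contradiction (trans (x∈⁅y⁆⇒x≡y u (subst (x ∈_) p─q≡⁅u⁆ x∈u))
      (sym (x∈⁅y⁆⇒x≡y u (subst (y ∈_) p─q≡⁅u⁆ y∈u)))) x≢y
  ... | inj₁ x∈u | inj₂ y∈v =
    subst₂ (Adj H) (sym (x∈⁅y⁆⇒x≡y u (subst (x ∈_) p─q≡⁅u⁆ x∈u)))
      (sym (x∈⁅y⁆⇒x≡y v (subst (y ∈_) q─p≡⁅v⁆ y∈v))) uv
  ... | inj₂ x∈v | inj₁ y∈u =
    subst₂ (Adj H) (sym (x∈⁅y⁆⇒x≡y v (subst (x ∈_) q─p≡⁅v⁆ x∈v)))
      (sym (x∈⁅y⁆⇒x≡y u (subst (y ∈_) p─q≡⁅u⁆ y∈u))) (adj-sym H uv)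
  ... | inj₂ x∈v | inj₂ y∈v =
    contradiction (trans (x∈⁅y⁆⇒x≡y v (subst (x ∈_) q─p≡⁅v⁆ x∈v))
      (sym (x∈⁅y⁆⇒x≡y v (subst (y ∈_) q─p≡⁅v⁆ y∈v)))) x≢y

  ∣△∣≡2 : ∀ {p q} → Slide H p q → ∣ p △ q ∣ ≡ 2
  ∣△∣≡2 {p} {q} (u , v , p─q≡⁅u⁆ , q─p≡⁅v⁆ , uv) = begin
    ∣ p △ q ∣         ≡⟨ cong ∣_∣ (cong₂ _∪_ p─q≡⁅u⁆ q─p≡⁅v⁆) ⟩
    ∣ ⁅ u ⁆ ∪ ⁅ v ⁆ ∣ ≡⟨ x∉p⇒∣p∪⁅x⁆∣≡1+∣p∣ v∉⁅u⁆ ⟩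
    suc ∣ ⁅ u ⁆ ∣     ≡⟨ cong suc (∣⁅x⁆∣≡1 u) ⟩
    2                 ∎
    where
    open ≡-Reasoning
    v∉⁅u⁆ : v ∉ˢ ⁅ u ⁆
    v∉⁅u⁆ v∈ = adj-irrefl H (sym (x∈⁅y⁆⇒x≡y u v∈)) uv

  no-common-slide : ∀ {h p q} → ∣ h ∣ ≡ 2 → Slide H h p → Slide H h q → ¬ Slide H h (p △ q)
  no-common-slide {h} {p} {q} ∣h∣≡2 hp hq hg = 2≢1+i+i i (begin
    1 + 1                     ≡⟨ cong₂ _+_ (Slide⇒∣∩∣≡1 ∣h∣≡2 hp) (Slide⇒∣∩∣≡1 ∣h∣≡2 hq) ⟨
    ∣ h ∩ p ∣ + ∣ h ∩ q ∣     ≡⟨ ∣h∩p∣+∣h∩q∣ h p q ⟩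
    ∣ h ∩ (p △ q) ∣ + (i + i) ≡⟨ cong (_+ (i + i)) (Slide⇒∣∩∣≡1 ∣h∣≡2 hg) ⟩
    1 + (i + i)               ∎)
    where
    open ≡-Reasoning
    i = ∣ h ∩ (p ∩ q) ∣

  -- The proofs stored in a refinement are irrelevant; decidability of equality on `ℕ`, and of `Adj`
  -- in `clique-adj`, makes them usable again.
  clique-size : ∀ {k} (A : Clique k H) → ∣ value A ∣ ≡ k
  clique-size (p , [ pf ]) = recompute (_ ≟ _) (proj₂ pf)

  clique-adj : ∀ {k} (A : Clique k H) → IsClique H (value A)
  clique-adj (p , [ pf ]) x∈p y∈p x≢y = recompute (adj? H _ _) (proj₁ pf x∈p y∈p x≢y)

  TS₂-edgesInMaximalTriangles : EdgesInMaximalTriangles (TS 2 H)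
  TS₂-edgesInMaximalTriangles A B AB =
    (value A △ value B , [ △-clique AB , ∣△∣≡2 AB ]) ,
    △-slide (clique-adj B) (clique-size A) AB ,
    subst (Slide H (value B)) (△-comm (value B) (value A))
      (△-slide (clique-adj A) (clique-size B) (adj-sym (TS 2 H) {A} {B} AB)) ,
    λ C → no-common-slide (clique-size C)

-- Johnson graphs

-- Two distinct singletons, with `k` common points put in front: `k + 2` points in all.
J-edge : ∀ {n} k → k + 2 ≤ n →
  Σ[ A ∈ Subset n ] Σ[ B ∈ Subset n ] ∣ A ∣ ≡ suc k × ∣ B ∣ ≡ suc k × ∣ A ∩ B ∣ ≡ k
J-edge {suc (suc n)} zero    (s≤s (s≤s _)) =
  true ∷ false ∷ ⊥ , false ∷ true ∷ ⊥ , cong suc (∣⊥∣≡0 n) , cong suc (∣⊥∣≡0 n) ,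
  trans (cong ∣_∣ (∩-idem (⊥ {n}))) (∣⊥∣≡0 n)
J-edge {suc n}       (suc k) (s≤s k+2≤n) with A , B , a , b , ab ← J-edge k k+2≤n =
  true ∷ A , true ∷ B , cong suc a , cong suc b , cong suc ab

module _ {n : ℕ} {A T : Subset n} {x : Fin n} where

  ∩-∪⁅⁆ : T ⊆ A → x ∉ˢ A → A ∩ (T ∪ ⁅ x ⁆) ≡ T
  ∩-∪⁅⁆ T⊆A x∉A = ⊆-antisym
    (λ {y} y∈ → let y∈A , y∈T∪x = x∈p∩q⁻ A (T ∪ ⁅ x ⁆) y∈ in
      [ (λ y∈T → y∈T)
      , (λ y∈x → contradiction (subst (_∈ A) (x∈⁅y⁆⇒x≡y x y∈x) y∈A) x∉A)
      ]′ (x∈p∪q⁻ T ⁅ x ⁆ y∈T∪x))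
    (λ y∈T → x∈p∩q⁺ (T⊆A y∈T , p⊆p∪q ⁅ x ⁆ y∈T))

  ∩-minus : A ⊆ T → A ∩ (T - x) ≡ A - x
  ∩-minus A⊆T = ⊆-antisym
    (λ y∈ → let y∈A , y∈T-x = x∈p∩q⁻ A (T - x) y∈ in
      x∈p∧x∉q⇒x∈p─q y∈A (x∈p─q⇒x∉q T ⁅ x ⁆ y∈T-x))
    (λ y∈ → let y∈A = p─q⊆p A ⁅ x ⁆ y∈ in
      x∈p∩q⁺ (y∈A , x∈p∧x∉q⇒x∈p─q (A⊆T y∈A) (x∈p─q⇒x∉q A ⁅ x ⁆ y∈)))

-- Extending triangles of `J n (suc s)` to 4-cliques

module _ {n s : ℕ} (A B C : Subset n)
  (∣A∣ : ∣ A ∣ ≡ suc s) (∣B∣ : ∣ B ∣ ≡ suc s) (∣C∣ : ∣ C ∣ ≡ suc s)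
  (∣AB∣ : ∣ A ∩ B ∣ ≡ s) (∣AC∣ : ∣ A ∩ C ∣ ≡ s) (∣BC∣ : ∣ B ∩ C ∣ ≡ s)
  where

  private
    -- `T` is the triple intersection, bracketed as the intersection of `A ∩ C` and `B ∩ C`. The
    -- union of these two is `W`, so inclusion-exclusion links the sizes of `T` and `W`.
    T U W : Subset n
    T = (A ∩ C) ∩ (B ∩ C)
    U = (A ∪ B) ∪ C
    W = (A ∪ B) ∩ C

    A⊆U : A ⊆ U
    A⊆U = p⊆p∪q C ∘ p⊆p∪q B

    B⊆U : B ⊆ U
    B⊆U = p⊆p∪q C ∘ q⊆p∪q A B

    C⊆U : C ⊆ U
    C⊆U = q⊆p∪q (A ∪ B) C

    T⊆A : T ⊆ A
    T⊆A = p∩q⊆p A C ∘ p∩q⊆p (A ∩ C) (B ∩ C)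

    T⊆B : T ⊆ B
    T⊆B = p∩q⊆p B C ∘ p∩q⊆q (A ∩ C) (B ∩ C)

    T⊆C : T ⊆ C
    T⊆C = p∩q⊆q A C ∘ p∩q⊆p (A ∩ C) (B ∩ C)

    ∣W∣+∣T∣ : ∣ W ∣ + ∣ T ∣ ≡ s + s
    ∣W∣+∣T∣ = begin
      ∣ W ∣ + ∣ T ∣                 ≡⟨ cong (λ p → ∣ p ∣ + ∣ T ∣) (∩-distribʳ-∪ C A B) ⟩
      ∣ (A ∩ C) ∪ (B ∩ C) ∣ + ∣ T ∣ ≡⟨ ∣p∪q∣+∣p∩q∣≡∣p∣+∣q∣ (A ∩ C) (B ∩ C) ⟩
      ∣ A ∩ C ∣ + ∣ B ∩ C ∣         ≡⟨ cong₂ _+_ ∣AC∣ ∣BC∣ ⟩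
      s + s                         ∎
      where open ≡-Reasoning

    ∣U∣+∣W∣ : ∣ U ∣ + ∣ W ∣ ≡ (3 + s) + s
    -- Adding `s`, in the guise of `∣ A ∩ B ∣`, to both sides avoids subtracting it to obtain
    -- `∣ A ∪ B ∣`.
    ∣U∣+∣W∣ = +-cancelʳ-≡ s _ _ (begin
      ∣ U ∣ + ∣ W ∣ + s                 ≡⟨ cong (_+ s) (∣p∪q∣+∣p∩q∣≡∣p∣+∣q∣ (A ∪ B) C) ⟩
      ∣ A ∪ B ∣ + ∣ C ∣ + s             ≡⟨ cong₂ (λ c i → ∣ A ∪ B ∣ + c + i) ∣C∣ (sym ∣AB∣) ⟩
      ∣ A ∪ B ∣ + suc s + ∣ A ∩ B ∣     ≡⟨ swap (∣ A ∪ B ∣) (suc s) (∣ A ∩ B ∣) ⟩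
      (∣ A ∪ B ∣ + ∣ A ∩ B ∣) + suc s   ≡⟨ cong (_+ suc s) (∣p∪q∣+∣p∩q∣≡∣p∣+∣q∣ A B) ⟩
      (∣ A ∣ + ∣ B ∣) + suc s           ≡⟨ cong₂ (λ a b → a + b + suc s) ∣A∣ ∣B∣ ⟩
      (suc s + suc s) + suc s           ≡⟨ collect s ⟩
      (3 + s) + s + s                   ∎)
      where
      open ≡-Reasoning
      swap : ∀ a b c → a + b + c ≡ (a + c) + b
      swap = solve-∀
      collect : ∀ s → (suc s + suc s) + suc s ≡ (3 + s) + s + s
      collect = solve-∀

    -- `W` contains `A ∩ C` and lies in `C`, so its size is `s` or `suc s`. These are the two types
    -- of triangle.
    s≤∣W∣ : s ≤ ∣ W ∣
    s≤∣W∣ = subst (_≤ ∣ W ∣) ∣AC∣ (p⊆q⇒∣p∣≤∣q∣ λ y∈ →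
      let y∈A , y∈C = x∈p∩q⁻ A C y∈ in x∈p∩q⁺ (p⊆p∪q B y∈A , y∈C))

    ∣W∣≤1+s : ∣ W ∣ ≤ suc s
    ∣W∣≤1+s = subst (∣ W ∣ ≤_) ∣C∣ (∣p∩q∣≤∣q∣ (A ∪ B) C)

  J-triangle⊆K₄ : 2 ≤ s → 3 + s < n → Σ[ D ∈ Subset n ]
    ∣ D ∣ ≡ suc s × ∣ A ∩ D ∣ ≡ s × ∣ B ∩ D ∣ ≡ s × ∣ C ∩ D ∣ ≡ s
  J-triangle⊆K₄ 2≤s 3+s<n with ∣ W ∣ ≤? s
  -- All pairwise intersections with `C` equal `T`, and each set is `T` plus one point. The union
  -- has `3 + s < n` points, so a new point `x` is available.
  ... | yes ∣W∣≤s = T ∪ ⁅ x ⁆ ,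
      trans (x∉p⇒∣p∪⁅x⁆∣≡1+∣p∣ (x∉U ∘ A⊆U ∘ T⊆A)) (cong suc ∣T∣≡s) ,
      meets T⊆A A⊆U , meets T⊆B B⊆U , meets T⊆C C⊆U
    where
    ∣W∣≡s = ≤-antisym ∣W∣≤s s≤∣W∣
    ∣T∣≡s : ∣ T ∣ ≡ s
    ∣T∣≡s = +-cancelˡ-≡ s _ _ (subst (λ w → w + ∣ T ∣ ≡ s + s) ∣W∣≡s ∣W∣+∣T∣)
    ∣U∣≡3+s : ∣ U ∣ ≡ 3 + s
    ∣U∣≡3+s = +-cancelʳ-≡ s _ _ (subst (λ w → ∣ U ∣ + w ≡ 3 + s + s) ∣W∣≡s ∣U∣+∣W∣)
    outside-U = ∣p∣<n⇒∃x∉p (subst (_< n) (sym ∣U∣≡3+s) 3+s<n)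
    x = proj₁ outside-U
    x∉U = proj₂ outside-U
    meets : ∀ {P} → T ⊆ P → P ⊆ U → ∣ P ∩ (T ∪ ⁅ x ⁆) ∣ ≡ s
    meets T⊆P P⊆U = trans (cong ∣_∣ (∩-∪⁅⁆ T⊆P (x∉U ∘ P⊆U))) ∣T∣≡s
  -- Now `C` lies in `A ∪ B`, and each set is `U` minus one point. A point `x` of `T` is missing
  -- from none of them, and `T` has `s` minus one points, at least one since `2 ≤ s`.
  ... | no ∣W∣≰s = U - x ,
      suc-injective (trans (x∈p⇒1+∣p-x∣≡∣p∣ (A⊆U (T⊆A x∈T))) ∣U∣≡2+s) ,
      meets ∣A∣ T⊆A A⊆U , meets ∣B∣ T⊆B B⊆U , meets ∣C∣ T⊆C C⊆U
    where
    ∣W∣≡1+s = ≤-antisym ∣W∣≤1+s (≰⇒> ∣W∣≰s)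
    1+∣T∣≡s : suc ∣ T ∣ ≡ s
    1+∣T∣≡s = +-cancelˡ-≡ s _ _
      (trans (+-suc s ∣ T ∣) (subst (λ w → w + ∣ T ∣ ≡ s + s) ∣W∣≡1+s ∣W∣+∣T∣))
    ∣U∣≡2+s : ∣ U ∣ ≡ 2 + s
    ∣U∣≡2+s = +-cancelʳ-≡ (suc s) _ _
      (trans (subst (λ w → ∣ U ∣ + w ≡ 3 + s + s) ∣W∣≡1+s ∣U∣+∣W∣) (sym (+-suc (2 + s) s)))
    inside-T = ∣p∣>0⇒Nonempty {p = T} (s≤s⁻¹ (subst (2 ≤_) (sym 1+∣T∣≡s) 2≤s))
    x = proj₁ inside-T
    x∈T = proj₂ inside-T
    meets : ∀ {P} → ∣ P ∣ ≡ suc s → T ⊆ P → P ⊆ U → ∣ P ∩ (U - x) ∣ ≡ s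
    meets ∣P∣ T⊆P P⊆U = suc-injective (trans (cong suc (cong ∣_∣ (∩-minus P⊆U)))
      (trans (x∈p⇒1+∣p-x∣≡∣p∣ (T⊆P x∈T)) ∣P∣))

subset-size : ∀ {n r} (A : SubsetOfSize n r) → ∣ value A ∣ ≡ r
subset-size (A , [ ∣A∣≡r ]) = recompute (_ ≟ _) ∣A∣≡r

-- A single edge refutes the property: whichever third vertex `C` is offered, a fourth vertex `D`
-- extends the triangle.
J-¬edgesInMaximalTriangles : ∀ {n r} → 3 ≤ r → r + 3 ≤ n → ¬ EdgesInMaximalTriangles (J n r)
J-¬edgesInMaximalTriangles {n} {suc s} (s≤s 2≤s) r+3≤n max
  with A , B , ∣A∣ , ∣B∣ , ∣AB∣ ← J-edge {n} s (≤-trans (+-mono-≤ (n≤1+n s) (n≤1+n 2)) r+3≤n)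
  with C , AC , BC , no-D ← max (A , [ ∣A∣ ]) (B , [ ∣B∣ ]) (cong suc ∣AB∣)
  with D , ∣D∣ , AD , BD , CD ← J-triangle⊆K₄ A B (value C) ∣A∣ ∣B∣ (subset-size C) ∣AB∣
         -- `3 + s < n` unfolds to `4 + s ≤ n`, which is `r + 3 ≤ n` for `r = suc s`, up to
         -- commutativity.
         (suc-injective AC) (suc-injective BC) 2≤s (subst (_≤ n) (+-comm (suc s) 3) r+3≤n)
  = no-D (D , [ ∣D∣ ]) (swap A AD) (swap B BD) (swap (value C) CD)
  where
  swap : ∀ P → ∣ P ∩ D ∣ ≡ s → suc ∣ D ∩ P ∣ ≡ suc s
  swap P PD = cong suc (trans (cong ∣_∣ (∩-comm D P)) PD)

theorem3p9 : ∀ (n r : ℕ) → 3 ≤ r → r + 3 ≤ n →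
    (¬ (∃[ m ] Σ[ H ∈ Graph (Fin m) ] TS 2 H ≅ J n r)) × (2 ∉ 𝒦ᵀˢ (J n r))
theorem3p9 n r 3≤r r+3≤n = ¬TS₂≅J , λ (_ , TS₂≅J) → ¬TS₂≅J TS₂≅J
  where
  ¬TS₂≅J : ¬ (∃[ m ] Σ[ H ∈ Graph (Fin m) ] TS 2 H ≅ J n r)
  ¬TS₂≅J (m , H , TS₂≅J) = J-¬edgesInMaximalTriangles 3≤r r+3≤n
    (EdgesInMaximalTriangles-resp-≅ (TS 2 H) (J n r) TS₂≅J (TS₂-edgesInMaximalTriangles H))
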